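{- Let $q$ be a prime power, $h\geq 2$, let $f,g:\mathbb{F}_{q^h}\to\mathbb{F}_q$ be nonzero $\mathbb{F}_q$-linear functionals and $\alpha\in\mathbb{F}_{q^h}\setminus\mathbb{F}_q$. Define the point sets of $\mathrm{PG}(2,q^h)$ $\mathcal{L}=\{(x:f(x):y): x\in\mathbb{F}_{q^h},\ y\in\mathbb{F}_q,\ (x,y)\neq(0,0)\}$ and $\mathcal{L}'=\{(y':x':g(x')+y'\alpha): x'\in\mathbb{F}_{q^h},\ y'\in\mathbb{F}_q,\ (x',y')\neq(0,0)\}$. Suppose that (1) $g(1)=g(\alpha)=1$; (2) $f(1/\alpha)\neq 0$; (3) $f\left(\frac{k-1}{k(k-1)\alpha-k^2}\right)\neq 1$ for all $k\in\mathbb{F}_q\setminus\{0,1\}$. Then $\mathcal{L}$ and $\mathcal{L}'$ are disjoint.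
   Context: Points of $\mathrm{PG}(2,q^h)$ are written in homogeneous coordinates $(a:b:c)$. -}

module Defs where

open import Algebra.Bundles using (CommutativeRing)
open import Algebra.Module.Bundles using (LeftModule)
import Algebra.Module.Construct.TensorUnit as TensorUnit
open import Algebra.Module.Morphism.Structures using (IsLeftModuleHomomorphism)
open import Algebra.Morphism.Structures using (IsRingMonomorphism)
import Algebra.Properties.Ring as RingProperties
open import Data.Fin.Base using (Fin)
open import Data.Nat.Base using (ℕ; _≤_; _^_)
open import Data.Nat.Primality using (Prime)
open import Data.Product.Base using (∃; ∃-syntax; _×_; _,_; proj₁; proj₂)
open import Function.Bundles using (Inverse)
open import Level using (Level; _⊔_) renaming (suc to lsuc)
open import Relation.Binary.Bundles using (Setoid)
open import Relation.Binary.PropositionalEquality.Core using (_≡_)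
import Relation.Binary.PropositionalEquality.Properties as ≡
import Relation.Binary.Reasoning.Setoid as SetoidReasoning
open import Relation.Nullary.Negation.Core using (¬_)
open import Relation.Unary using (Pred)

IsPrimePower : ℕ → Set
IsPrimePower q = ∃[ p ] ∃[ n ] (Prime p × 1 ≤ n × q ≡ p ^ n)

record Field (c ℓ : Level) : Set (lsuc (c ⊔ ℓ)) where
  field
    commutativeRing : CommutativeRing c ℓ

  open CommutativeRing commutativeRing public

  field
    1≉0     : 1# ≉ 0#
    inverse : ∀ x → x ≉ 0# → ∃[ y ] x * y ≈ 1#

  infixl 7 _/_[_]

  _/_[_] : (x y : Carrier) → y ≉ 0# → Carrier
  x / y [ y≉0 ] = x * proj₁ (inverse y y≉0)

HasOrder : ∀ {c ℓ} → Field c ℓ → ℕ → Set (c ⊔ ℓ)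
HasOrder F n = Inverse (≡.setoid (Fin n)) (Field.setoid F)

-- A field extension K/F, given by an embedding ι of F in K.
record Extension {c₁ ℓ₁ c₂ ℓ₂} (F : Field c₁ ℓ₁) (K : Field c₂ ℓ₂)
                 : Set (c₁ ⊔ ℓ₁ ⊔ c₂ ⊔ ℓ₂) where
  private
    module F = Field F
    module K = Field K

  field
    ι                  : F.Carrier → K.Carrier
    isRingMonomorphism : IsRingMonomorphism F.rawRing K.rawRing ι

  open IsRingMonomorphism isRingMonomorphism public

  InBase : Pred K.Carrier (c₁ ⊔ ℓ₂)
  InBase x = ∃[ a ] ι a K.≈ x

  -- K as a vector space over F, by restriction of scalars along ι.
  vectorSpace : LeftModule F.ring c₂ ℓ₂
  vectorSpace = record
    { Carrierᴹ = K.Carrier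
    ; _≈ᴹ_     = K._≈_
    ; _+ᴹ_     = K._+_
    ; _*ₗ_     = λ a x → ι a K.* x
    ; 0ᴹ       = K.0#
    ; -ᴹ_      = K.-_
    ; isLeftModule = record
      { isLeftSemimodule = record
        { +ᴹ-isCommutativeMonoid = K.+-isCommutativeMonoid
        ; isPreleftSemimodule = record
          { *ₗ-cong      = λ a≈b x≈y → K.*-cong (⟦⟧-cong a≈b) x≈y
          ; *ₗ-zeroˡ     = λ x → K.trans (K.*-congʳ 0#-homo) (K.zeroˡ x)
          ; *ₗ-distribʳ  = λ x a b → K.trans (K.*-congʳ (+-homo a b)) (K.distribʳ x (ι a) (ι b))
          ; *ₗ-identityˡ = λ x → K.trans (K.*-congʳ 1#-homo) (K.*-identityˡ x)
          ; *ₗ-assoc     = λ a b x → K.trans (K.*-congʳ (*-homo a b)) (K.*-assoc (ι a) (ι b) x)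
          ; *ₗ-zeroʳ     = λ a → K.zeroʳ (ι a)
          ; *ₗ-distribˡ  = λ a → K.distribˡ (ι a)
          }
        }
      ; -ᴹ‿cong    = K.-‿cong
      ; -ᴹ‿inverse = K.-‿inverse
      }
    }

  IsLinearFunctional : (K.Carrier → F.Carrier) → Set (c₁ ⊔ ℓ₁ ⊔ c₂ ⊔ ℓ₂)
  IsLinearFunctional = IsLeftModuleHomomorphism
    (LeftModule.rawLeftModule vectorSpace)
    (LeftModule.rawLeftModule (TensorUnit.leftModule {R = F.ring}))

  IsNonzeroFunctional : (K.Carrier → F.Carrier) → Set (ℓ₁ ⊔ c₂)
  IsNonzeroFunctional f = ¬ (∀ x → f x F.≈ F.0#)

  ι≈0⇒≈0 : ∀ {a} → ι a K.≈ K.0# → a F.≈ F.0#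
  ι≈0⇒≈0 ιa≈0 = injective (K.trans ιa≈0 (K.sym 0#-homo))

  ∉Base⇒≉0 : ∀ {α} → ¬ InBase α → α K.≉ K.0#
  ∉Base⇒≉0 α∉F α≈0 = α∉F (F.0# , K.trans 0#-homo (K.sym α≈0))

  -- The denominator k(k-1)α - k² of the third condition on f.
  denominator : F.Carrier → K.Carrier → K.Carrier
  denominator k α = ι k K.* (ι k K.- K.1#) K.* α K.- ι k K.* ι k

  denominator≉0 : ∀ {α} → ¬ InBase α → ∀ {k} → k F.≉ F.0# → k F.≉ F.1# →
                  denominator k α K.≉ K.0#
  denominator≉0 {α} α∉F {k} k≉0 k≉1 d≈0 = α∉F (j F.* k , ιjk≈α)
    where
    open RingProperties K.ring using (x∙y⁻¹≈ε⇒x≈y)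
    module FP = RingProperties F.ring
    open SetoidReasoning K.setoid

    k-1≉0 : k F.- F.1# F.≉ F.0#
    k-1≉0 k-1≈0 = k≉1 (FP.x∙y⁻¹≈ε⇒x≈y k F.1# k-1≈0)

    i j : F.Carrier
    i = proj₁ (F.inverse k k≉0)
    j = proj₁ (F.inverse (k F.- F.1#) k-1≉0)

    ιi*ιk≈1 : ι i K.* ι k K.≈ K.1#
    ιi*ιk≈1 = begin
      ι i K.* ι k    ≈⟨ *-homo i k ⟨
      ι (i F.* k)    ≈⟨ ⟦⟧-cong (F.trans (F.*-comm i k) (proj₂ (F.inverse k k≉0))) ⟩
      ι F.1#         ≈⟨ 1#-homo ⟩
      K.1#           ∎

    ι[k-1] : ι (k F.- F.1#) K.≈ ι k K.- K.1#
    ι[k-1] = K.trans (+-homo k (F.- F.1#))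
      (K.+-congˡ (K.trans (-‿homo F.1#) (K.-‿cong 1#-homo)))

    ιj*[ιk-1]≈1 : ι j K.* (ι k K.- K.1#) K.≈ K.1#
    ιj*[ιk-1]≈1 = begin
      ι j K.* (ι k K.- K.1#)      ≈⟨ K.*-congˡ ι[k-1] ⟨
      ι j K.* ι (k F.- F.1#)      ≈⟨ *-homo j _ ⟨
      ι (j F.* (k F.- F.1#))
        ≈⟨ ⟦⟧-cong (F.trans (F.*-comm j _) (proj₂ (F.inverse (k F.- F.1#) k-1≉0))) ⟩
      ι F.1#                      ≈⟨ 1#-homo ⟩
      K.1#                        ∎

    cancel : ∀ {a b} x → a K.* b K.≈ K.1# → a K.* (b K.* x) K.≈ x
    cancel {a} {b} x ab≈1 = begin
      a K.* (b K.* x)  ≈⟨ K.*-assoc a b x ⟨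
      a K.* b K.* x    ≈⟨ K.*-congʳ ab≈1 ⟩
      K.1# K.* x       ≈⟨ K.*-identityˡ x ⟩
      x                ∎

    ιk≈[ιk-1]α : ι k K.≈ (ι k K.- K.1#) K.* α
    ιk≈[ιk-1]α = begin
      ι k                                            ≈⟨ cancel (ι k) ιi*ιk≈1 ⟨
      ι i K.* (ι k K.* ι k)                          ≈⟨ K.*-congˡ (x∙y⁻¹≈ε⇒x≈y _ _ d≈0) ⟨
      ι i K.* (ι k K.* (ι k K.- K.1#) K.* α)         ≈⟨ K.*-congˡ (K.*-assoc _ _ _) ⟩
      ι i K.* (ι k K.* ((ι k K.- K.1#) K.* α))       ≈⟨ cancel _ ιi*ιk≈1 ⟩
      (ι k K.- K.1#) K.* α                           ∎

    ιjk≈α : ι (j F.* k) K.≈ α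
    ιjk≈α = begin
      ι (j F.* k)                        ≈⟨ *-homo j k ⟩
      ι j K.* ι k                        ≈⟨ K.*-congˡ ιk≈[ιk-1]α ⟩
      ι j K.* ((ι k K.- K.1#) K.* α)     ≈⟨ cancel α ιj*[ιk-1]≈1 ⟩
      α                                  ∎

-- PG(2,K): nonzero triples, identified when they differ by a nonzero scalar.
module ProjectivePlane {c ℓ} (K : Field c ℓ) where
  open Field K

  record Point : Set (c ⊔ ℓ) where
    constructor ⟨_∶_∶_⟩[_]
    field
      X Y Z   : Carrier
      nonzero : ¬ (X ≈ 0# × Y ≈ 0# × Z ≈ 0#)

  infix 4 _∼_

  _∼_ : Point → Point → Set (c ⊔ ℓ)
  P ∼ Q = ∃[ μ ] (μ ≉ 0# × P.X ≈ μ * Q.X × P.Y ≈ μ * Q.Y × P.Z ≈ μ * Q.Z)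
    where
    module P = Point P
    module Q = Point Q

  ∼-refl : ∀ {P} → P ∼ P
  ∼-refl = 1# , 1≉0 , sym (*-identityˡ _) , sym (*-identityˡ _) , sym (*-identityˡ _)

  ∼-sym : ∀ {P Q} → P ∼ Q → Q ∼ P
  ∼-sym {P} {Q} (μ , μ≉0 , eX , eY , eZ) = ν , ν≉0 , flip eX , flip eY , flip eZ
    where
    ν : Carrier
    ν = proj₁ (inverse μ μ≉0)

    μν≈1 : μ * ν ≈ 1#
    μν≈1 = proj₂ (inverse μ μ≉0)

    ν≉0 : ν ≉ 0#
    ν≉0 ν≈0 = 1≉0 (trans (sym μν≈1) (trans (*-congˡ ν≈0) (zeroʳ μ)))

    flip : ∀ {a b} → a ≈ μ * b → b ≈ ν * a
    flip {a} {b} a≈μb = begin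
      b            ≈⟨ *-identityˡ b ⟨
      1# * b       ≈⟨ *-congʳ (trans (*-comm ν μ) μν≈1) ⟨
      ν * μ * b    ≈⟨ *-assoc ν μ b ⟩
      ν * (μ * b)  ≈⟨ *-congˡ a≈μb ⟨
      ν * a        ∎
      where open SetoidReasoning setoid

  ∼-trans : ∀ {P Q R} → P ∼ Q → Q ∼ R → P ∼ R
  ∼-trans {P} (μ , μ≉0 , eX , eY , eZ) (ν , ν≉0 , dX , dY , dZ) =
    μ * ν , μν≉0 , comp eX dX , comp eY dY , comp eZ dZ
    where
    comp : ∀ {a b d} → a ≈ μ * b → b ≈ ν * d → a ≈ μ * ν * d
    comp p r = trans p (trans (*-congˡ r) (sym (*-assoc μ ν _)))

    μν≉0 : μ * ν ≉ 0#
    μν≉0 μν≈0 = Point.nonzero P (vanish (comp eX dX) , vanish (comp eY dY) , vanish (comp eZ dZ))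
      where
      vanish : ∀ {a d} → a ≈ μ * ν * d → a ≈ 0#
      vanish e = trans e (trans (*-congʳ μν≈0) (zeroˡ _))

  PG2 : Setoid (c ⊔ ℓ) (c ⊔ ℓ)
  PG2 = record
    { Carrier       = Point
    ; _≈_           = _∼_
    ; isEquivalence = record
      { refl  = λ {P} → ∼-refl {P}
      ; sym   = λ {P} {Q} → ∼-sym {P} {Q}
      ; trans = λ {P} {Q} {R} → ∼-trans {P} {Q} {R}
      }
    }

module LinearSets {c₁ ℓ₁ c₂ ℓ₂} {F : Field c₁ ℓ₁} {K : Field c₂ ℓ₂} (E : Extension F K) where
  open Extension E using (ι; ι≈0⇒≈0)
  open ProjectivePlane K
  private
    module F = Field F
    module K = Field K

  Nonzero : K.Carrier → F.Carrier → Set (ℓ₁ ⊔ ℓ₂)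
  Nonzero x y = ¬ (x K.≈ K.0# × y F.≈ F.0#)

  point : (f : K.Carrier → F.Carrier) (x : K.Carrier) (y : F.Carrier) → Nonzero x y → Point
  point f x y nz = ⟨ x ∶ ι (f x) ∶ ι y ⟩[ (λ (x≈0 , _ , ιy≈0) → nz (x≈0 , ι≈0⇒≈0 ιy≈0)) ]

  point′ : (g : K.Carrier → F.Carrier) (α : K.Carrier)
           (x : K.Carrier) (y : F.Carrier) → Nonzero x y → Point
  point′ g α x y nz =
    ⟨ ι y ∶ x ∶ ι (g x) K.+ ι y K.* α ⟩[ (λ (ιy≈0 , x≈0 , _) → nz (x≈0 , ι≈0⇒≈0 ιy≈0)) ]

  𝓛 : (K.Carrier → F.Carrier) → Pred Point (c₁ ⊔ ℓ₁ ⊔ c₂ ⊔ ℓ₂)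
  𝓛 f P = ∃[ x ] ∃[ y ] ∃[ nz ] P ∼ point f x y nz

  𝓛′ : (K.Carrier → F.Carrier) → K.Carrier → Pred Point (c₁ ⊔ ℓ₁ ⊔ c₂ ⊔ ℓ₂)
  𝓛′ g α P = ∃[ x ] ∃[ y ] ∃[ nz ] P ∼ point′ g α x y nz

{-# OPTIONS --safe #-}
-- A common point gives u ∈ K and k, t ∈ F with u(t + α) = 1, f(u) = k and,
-- after applying g to the second coordinate, t = kt + k.  Hence k ≠ 1; if k = 0
-- then t = 0 and u = 1/α, against (2); otherwise t = -k/(k - 1), so that
-- u/k = (k - 1)/(k(k - 1)α - k²) and f(u/k) = 1, against (3).
module Submission where

open import Defs
open import Algebra.Module.Morphism.Structures using (IsLeftModuleHomomorphism)
import Algebra.Properties.Ring as RingProperties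
import Algebra.Solver.Ring.NaturalCoefficients.Default as SemiringSolver
open import Data.Nat.Base using (ℕ; _≤_; _^_)
open import Data.Product.Base using (_,_; proj₁; proj₂)
import Relation.Binary.Reasoning.Setoid as SetoidReasoning
open import Relation.Nullary.Negation.Core using (¬_)
open import Relation.Unary using (_⊥_)

module FieldProperties {c ℓ} (K : Field c ℓ) where
  open Field K
  open SetoidReasoning setoid

  infix 8 _⁻¹[_]

  _⁻¹[_] : ∀ x → x ≉ 0# → Carrier
  x ⁻¹[ x≉0 ] = proj₁ (inverse x x≉0)

  *-inverseʳ : ∀ {x} (x≉0 : x ≉ 0#) → x * x ⁻¹[ x≉0 ] ≈ 1#
  *-inverseʳ x≉0 = proj₂ (inverse _ x≉0)

  *-inverseˡ : ∀ {x} (x≉0 : x ≉ 0#) → x ⁻¹[ x≉0 ] * x ≈ 1#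
  *-inverseˡ x≉0 = trans (*-comm _ _) (*-inverseʳ x≉0)

  -- This is how `u` is later matched with the fractions in conditions (2) and (3): a product
  -- identity pins down the quotient, whatever inverse was chosen.
  x*y≈z⇒x≈z/y : ∀ {x y z} (y≉0 : y ≉ 0#) → x * y ≈ z → x ≈ z / y [ y≉0 ]
  x*y≈z⇒x≈z/y {x} {y} {z} y≉0 xy≈z = begin
    x                       ≈⟨ *-identityʳ x ⟨
    x * 1#                  ≈⟨ *-congˡ (*-inverseʳ y≉0) ⟨
    x * (y * y ⁻¹[ y≉0 ])   ≈⟨ *-assoc _ _ _ ⟨
    x * y * y ⁻¹[ y≉0 ]     ≈⟨ *-congʳ xy≈z ⟩
    z / y [ y≉0 ]           ∎

  *-cancelʳ : ∀ {x y z} → z ≉ 0# → x * z ≈ y * z → x ≈ y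
  *-cancelʳ z≉0 xz≈yz = trans (x*y≈z⇒x≈z/y z≉0 xz≈yz) (sym (x*y≈z⇒x≈z/y z≉0 refl))

  x*y≈0⇒y≈0 : ∀ {x y} → x ≉ 0# → x * y ≈ 0# → y ≈ 0#
  x*y≈0⇒y≈0 {x} {y} x≉0 xy≈0 =
    *-cancelʳ x≉0 (trans (*-comm y x) (trans xy≈0 (sym (zeroˡ x))))

module ExtensionProperties {c₁ ℓ₁ c₂ ℓ₂} {F : Field c₁ ℓ₁} {K : Field c₂ ℓ₂}
                           (E : Extension F K) where
  private
    module F  = Field F
    module K  = Field K
    module FP = FieldProperties F
    module KP = FieldProperties K
    module FR = RingProperties F.ring
    module KR = RingProperties K.ring
  open Extension E
  open LinearSets E
  open ProjectivePlane K using (_∼_; ∼-sym; ∼-trans)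

  ι-inverseˡ : ∀ {a} (a≉0 : a F.≉ F.0#) → ι (a FP.⁻¹[ a≉0 ]) K.* ι a K.≈ K.1#
  ι-inverseˡ a≉0 = K.trans (K.sym (*-homo _ _)) (K.trans (⟦⟧-cong (FP.*-inverseˡ a≉0)) 1#-homo)

  -- Otherwise `α` would be the image of `-a/b`, an element of the base field. It serves to show
  -- that the third coordinate of a point of `𝓛′` does not vanish when `y′` is nonzero.
  a+bα≉0 : ∀ {α} → ¬ InBase α → ∀ {a b} → b F.≉ F.0# → ι a K.+ ι b K.* α K.≉ K.0#
  a+bα≉0 {α} α∉F {a} {b} b≉0 a+bα≈0 = α∉F (i F.* (F.- a) , (begin
    ι (i F.* (F.- a))    ≈⟨ *-homo _ _ ⟩
    ι i K.* ι (F.- a)    ≈⟨ K.*-congˡ (-‿homo a) ⟩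
    ι i K.* (K.- ι a)    ≈⟨ K.*-congˡ (KR.+-inverseʳ-unique (ι a) _ a+bα≈0) ⟨
    ι i K.* (ι b K.* α)  ≈⟨ K.*-assoc _ _ _ ⟨
    ι i K.* ι b K.* α    ≈⟨ K.*-congʳ (ι-inverseˡ b≉0) ⟩
    K.1# K.* α           ≈⟨ K.*-identityˡ α ⟩
    α                    ∎))
    where
    open SetoidReasoning K.setoid
    i = b FP.⁻¹[ b≉0 ]

  -- The hypothesis rearranges to (k - 1)t = -k, so the term -k² is k(k - 1)t and joins k(k - 1)α.
  -- Nothing is divided, so `k` needs no restriction.
  denominator-factor : ∀ {k t α} → t F.≈ k F.* t F.+ k →
    denominator k α K.≈ ι k K.* (ι k K.- K.1#) K.* (ι t K.+ α)
  denominator-factor {k} {t} {α} t≈kt+k = begin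
    c K.* n K.* α K.- c K.* c            ≈⟨ K.+-congˡ (KR.-‿distribʳ-* c c) ⟩
    c K.* n K.* α K.+ c K.* (K.- c)      ≈⟨ K.+-congˡ (K.*-congˡ nT≈-c) ⟨
    c K.* n K.* α K.+ c K.* (n K.* T)
      -- With the minus sign already absorbed and `n` kept as an atom, this is a semiring identity.
      ≈⟨ solve 4 (λ c n T α → c :* n :* α :+ c :* (n :* T) := c :* n :* (T :+ α)) K.refl c n T α ⟩
    c K.* n K.* (T K.+ α)                ∎
    where
    open SetoidReasoning K.setoid
    open SemiringSolver K.commutativeSemiring
    c = ι k
    n = c K.- K.1#
    T = ι t

    T≈cT+c : T K.≈ c K.* T K.+ c
    T≈cT+c = K.trans (⟦⟧-cong t≈kt+k) (K.trans (+-homo _ _) (K.+-congʳ (*-homo _ _)))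

    nT≈-c : n K.* T K.≈ K.- c
    nT≈-c = KR.+-inverseˡ-unique _ _ (begin
      n K.* T K.+ c                              ≈⟨ K.+-congʳ (K.distribʳ T c (K.- K.1#)) ⟩
      c K.* T K.+ (K.- K.1#) K.* T K.+ c         ≈⟨ K.+-congʳ (K.+-congˡ (KR.-1*x≈-x T)) ⟩
      c K.* T K.- T K.+ c
        ≈⟨ solve 3 (λ x y z → x :+ y :+ z := x :+ z :+ y) K.refl (c K.* T) (K.- T) c ⟩
      c K.* T K.+ c K.- T                        ≈⟨ K.+-congʳ T≈cT+c ⟨
      T K.- T                                    ≈⟨ K.-‿inverseʳ T ⟩
      K.0#                                       ∎)

  module _ {f : K.Carrier → F.Carrier} (f-linear : IsLinearFunctional f)
           {α : K.Carrier} (α∉F : ¬ InBase α)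
           (f[1/α]≉0 : f (K.1# K./ α [ ∉Base⇒≉0 α∉F ]) F.≉ F.0#)
           (f≉1 : ∀ k (k≉0 : k F.≉ F.0#) (k≉1 : k F.≉ F.1#) →
             f ((ι k K.- K.1#) K./ denominator k α [ denominator≉0 α∉F k≉0 k≉1 ]) F.≉ F.1#)
           where
    private module f = IsLeftModuleHomomorphism f-linear

    -- All uses of conditions (2) and (3) are here: (2) excludes f(u) = 0 and (3) excludes every
    -- value other than 0 and 1. The remaining value 1 is impossible in any field.
    t≉f[u]t+f[u] : ∀ {u t} → u K.* (ι t K.+ α) K.≈ K.1# → ¬ (t F.≈ f u F.* t F.+ f u)
    t≉f[u]t+f[u] {u} {t} u[t+α]≈1 t≈kt+k = f≉1 k k≉0 k≉1 f[w]≈1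
      where
      k = f u

      k≉0 : k F.≉ F.0#
      k≉0 k≈0 = f[1/α]≉0 (F.trans (f.⟦⟧-cong (K.sym (KP.x*y≈z⇒x≈z/y _ uα≈1))) k≈0)
        where
        t≈0 : t F.≈ F.0#
        t≈0 = begin
          t                     ≈⟨ t≈kt+k ⟩
          k F.* t F.+ k         ≈⟨ F.+-cong (F.*-congʳ k≈0) k≈0 ⟩
          F.0# F.* t F.+ F.0#   ≈⟨ F.+-identityʳ _ ⟩
          F.0# F.* t            ≈⟨ F.zeroˡ t ⟩
          F.0#                  ∎
          where open SetoidReasoning F.setoid

        uα≈1 : u K.* α K.≈ K.1#
        uα≈1 = begin
          u K.* α                ≈⟨ K.*-congˡ (K.+-identityˡ α) ⟨
          u K.* (K.0# K.+ α)     ≈⟨ K.*-congˡ (K.+-congʳ (K.trans (⟦⟧-cong t≈0) 0#-homo)) ⟨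
          u K.* (ι t K.+ α)      ≈⟨ u[t+α]≈1 ⟩
          K.1#                   ∎
          where open SetoidReasoning K.setoid

      -- For k = 1 the equation reads t = t + 1, and cancelling `t` leaves 1 = 0.
      k≉1 : k F.≉ F.1#
      k≉1 k≈1 = F.1≉0 (FR.+-cancelˡ t _ _ (begin
        t F.+ F.1#            ≈⟨ F.+-cong (F.trans (F.*-congʳ k≈1) (F.*-identityˡ t)) k≈1 ⟨
        k F.* t F.+ k         ≈⟨ t≈kt+k ⟨
        t                     ≈⟨ F.+-identityʳ t ⟨
        t F.+ F.0#            ∎))
        where open SetoidReasoning F.setoid

      d≉0 = denominator≉0 α∉F k≉0 k≉1
      n   = ι k K.- K.1#
      w   = n K./ denominator k α [ d≉0 ]

      -- By the factorisation, `u` times the denominator is k(k - 1) · u(t + α) = k(k - 1).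
      u≈kw : u K.≈ ι k K.* w
      u≈kw = K.trans (KP.x*y≈z⇒x≈z/y d≉0 (begin
        u K.* denominator k α                     ≈⟨ K.*-congˡ (denominator-factor t≈kt+k) ⟩
        u K.* (ι k K.* n K.* (ι t K.+ α))
          ≈⟨ solve 3 (λ u m s → u :* (m :* s) := m :* (u :* s)) K.refl u (ι k K.* n) (ι t K.+ α) ⟩
        ι k K.* n K.* (u K.* (ι t K.+ α))         ≈⟨ K.*-congˡ u[t+α]≈1 ⟩
        ι k K.* n K.* K.1#                        ≈⟨ K.*-identityʳ _ ⟩
        ι k K.* n                                 ∎)) (K.*-assoc _ _ _)
        where
        open SetoidReasoning K.setoid
        open SemiringSolver K.commutativeSemiring

      -- Linearity turns u = kw into k = f(u) = k f(w), and the nonzero `k` cancels.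
      f[w]≈1 : f w F.≈ F.1#
      f[w]≈1 = FP.*-cancelʳ k≉0 (begin
        f w F.* k         ≈⟨ F.*-comm _ _ ⟩
        k F.* f w         ≈⟨ f.*ₗ-homo k w ⟨
        f (ι k K.* w)     ≈⟨ f.⟦⟧-cong u≈kw ⟨
        k                 ≈⟨ F.*-identityˡ k ⟨
        F.1# F.* k        ∎)
        where open SetoidReasoning F.setoid

    module _ {g : K.Carrier → F.Carrier} (g-linear : IsLinearFunctional g)
             (g[1]≈1 : g K.1# F.≈ F.1#) (g[α]≈1 : g α F.≈ F.1#) where
      private module g = IsLeftModuleHomomorphism g-linear

      -- Put u = x/y and t = g(x′)/y′. The first and third coordinates give u(t + α) = 1; the first
      -- two give f(u)(t + α) = x′/y′. Applying `g` to the latter yields the equation excluded by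
      -- `t≉f[u]t+f[u]`.
      points-distinct : ∀ {x y nz x′ y′ nz′} → ¬ (point f x y nz ∼ point′ g α x′ y′ nz′)
      points-distinct {x} {y} {nz} {x′} {y′} {nz′} (μ , μ≉0 , x≈μy′ , fx≈μx′ , y≈μz′) =
        t≉f[u]t+f[u] u[t+α]≈1 t≈kt+k
        where
        open SemiringSolver K.commutativeSemiring

        -- If y′ = 0, the first coordinate forces x = 0, hence f(x) = 0, and the second forces x′ =
        -- 0, contradicting `nz′`.
        y′≉0 : y′ F.≉ F.0#
        y′≉0 y′≈0 = nz′ (KP.x*y≈0⇒y≈0 μ≉0 μx′≈0 , y′≈0)
          where
          open SetoidReasoning K.setoid

          x≈0 : x K.≈ K.0#
          x≈0 = begin
            x              ≈⟨ x≈μy′ ⟩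
            μ K.* ι y′     ≈⟨ K.*-congˡ (K.trans (⟦⟧-cong y′≈0) 0#-homo) ⟩
            μ K.* K.0#     ≈⟨ K.zeroʳ μ ⟩
            K.0#           ∎

          μx′≈0 : μ K.* x′ K.≈ K.0#
          μx′≈0 = begin
            μ K.* x′       ≈⟨ fx≈μx′ ⟨
            ι (f x)        ≈⟨ ⟦⟧-cong (F.trans (f.⟦⟧-cong x≈0) f.0ᴹ-homo) ⟩
            ι F.0#         ≈⟨ 0#-homo ⟩
            K.0#           ∎

        y≉0 : y F.≉ F.0#
        y≉0 y≈0 = a+bα≉0 α∉F y′≉0 (KP.x*y≈0⇒y≈0 μ≉0
          (K.trans (K.sym y≈μz′) (K.trans (⟦⟧-cong y≈0) 0#-homo)))

        -- Both inverses are taken in `F`, so that `f` and `g` commute with these scalings.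
        i = y′ FP.⁻¹[ y′≉0 ]
        j = y FP.⁻¹[ y≉0 ]
        t = i F.* g x′
        u = ι j K.* x
        s = ι t K.+ α

        y′s≈z′ : ι y′ K.* s K.≈ ι (g x′) K.+ ι y′ K.* α
        y′s≈z′ = begin
          ι y′ K.* (ι t K.+ α)             ≈⟨ K.distribˡ _ _ _ ⟩
          ι y′ K.* ι t K.+ ι y′ K.* α      ≈⟨ K.+-congʳ (K.*-congˡ (*-homo i (g x′))) ⟩
          ι y′ K.* (ι i K.* ι (g x′)) K.+ ι y′ K.* α
            ≈⟨ K.+-congʳ (solve 3 (λ a b c → a :* (b :* c) := b :* a :* c) K.refl _ _ _) ⟩
          ι i K.* ι y′ K.* ι (g x′) K.+ ι y′ K.* α
            ≈⟨ K.+-congʳ (K.trans (K.*-congʳ (ι-inverseˡ y′≉0)) (K.*-identityˡ _)) ⟩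
          ι (g x′) K.+ ι y′ K.* α          ∎
          where open SetoidReasoning K.setoid

        u[t+α]≈1 : u K.* s K.≈ K.1#
        u[t+α]≈1 = begin
          ι j K.* x K.* s                  ≈⟨ K.*-congʳ (K.*-congˡ x≈μy′) ⟩
          ι j K.* (μ K.* ι y′) K.* s
            ≈⟨ solve 4 (λ j m a s → j :* (m :* a) :* s := j :* (m :* (a :* s))) K.refl _ _ _ _ ⟩
          ι j K.* (μ K.* (ι y′ K.* s))     ≈⟨ K.*-congˡ (K.*-congˡ y′s≈z′) ⟩
          ι j K.* (μ K.* (ι (g x′) K.+ ι y′ K.* α))  ≈⟨ K.*-congˡ y≈μz′ ⟨
          ι j K.* ι y                      ≈⟨ ι-inverseˡ y≉0 ⟩
          K.1#                             ∎
          where open SetoidReasoning K.setoid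

        -- Inserting (1/y′)y′ = 1 allows `x′` and `y′` to trade places; then μy′ is `x` again, and
        -- `μ` disappears without being inverted.
        f[u]s≈x′/y′ : ι (f u) K.* s K.≈ ι i K.* x′
        f[u]s≈x′/y′ = begin
          ι (f u) K.* s                          ≈⟨ K.*-congʳ (⟦⟧-cong (f.*ₗ-homo j x)) ⟩
          ι (j F.* f x) K.* s                    ≈⟨ K.*-congʳ (*-homo j (f x)) ⟩
          ι j K.* ι (f x) K.* s                  ≈⟨ K.*-congʳ (K.*-congˡ fx≈μx′) ⟩
          ι j K.* (μ K.* x′) K.* s               ≈⟨ K.*-identityˡ _ ⟨
          K.1# K.* (ι j K.* (μ K.* x′) K.* s)    ≈⟨ K.*-congʳ (ι-inverseˡ y′≉0) ⟨
          ι i K.* ι y′ K.* (ι j K.* (μ K.* x′) K.* s)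
            ≈⟨ solve 6 (λ i a j m x s → i :* a :* (j :* (m :* x) :* s) := i :* x :* (j :* (m :* a) :* s))
                 K.refl _ _ _ _ _ _ ⟩
          ι i K.* x′ K.* (ι j K.* (μ K.* ι y′) K.* s)  ≈⟨ K.*-congˡ (K.*-congʳ (K.*-congˡ x≈μy′)) ⟨
          ι i K.* x′ K.* (u K.* s)               ≈⟨ K.*-congˡ u[t+α]≈1 ⟩
          ι i K.* x′ K.* K.1#                    ≈⟨ K.*-identityʳ _ ⟩
          ι i K.* x′                             ∎
          where open SetoidReasoning K.setoid

        -- The factors `i` and `f u` are base scalars and come out of `g`; condition (1) gives g(t +
        -- α) = t + 1.
        t≈kt+k : t F.≈ f u F.* t F.+ f u
        t≈kt+k = begin
          i F.* g x′                      ≈⟨ g.*ₗ-homo i x′ ⟨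
          g (ι i K.* x′)                  ≈⟨ g.⟦⟧-cong f[u]s≈x′/y′ ⟨
          g (ι (f u) K.* s)               ≈⟨ g.*ₗ-homo (f u) s ⟩
          f u F.* g (ι t K.+ α)           ≈⟨ F.*-congˡ (g.+ᴹ-homo (ι t) α) ⟩
          f u F.* (g (ι t) F.+ g α)       ≈⟨ F.*-congˡ (F.+-cong g[ιt]≈t g[α]≈1) ⟩
          f u F.* (t F.+ F.1#)            ≈⟨ F.distribˡ _ _ _ ⟩
          f u F.* t F.+ f u F.* F.1#      ≈⟨ F.+-congˡ (F.*-identityʳ _) ⟩
          f u F.* t F.+ f u               ∎
          where
          open SetoidReasoning F.setoid

          g[ιt]≈t : g (ι t) F.≈ t
          g[ιt]≈t = begin
            g (ι t)              ≈⟨ g.⟦⟧-cong (K.*-identityʳ (ι t)) ⟨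
            g (ι t K.* K.1#)     ≈⟨ g.*ₗ-homo t K.1# ⟩
            t F.* g K.1#         ≈⟨ F.*-congˡ g[1]≈1 ⟩
            t F.* F.1#           ≈⟨ F.*-identityʳ t ⟩
            t                    ∎

      𝓛⊥𝓛′ : 𝓛 f ⊥ 𝓛′ g α
      𝓛⊥𝓛′ {P} ((x , y , nz , P∼Q) , (x′ , y′ , nz′ , P∼R)) =
        points-distinct {nz = nz} {nz′ = nz′}
          (∼-trans {Q} {P} {R} (∼-sym {P} {Q} P∼Q) P∼R)
        where
        Q = point f x y nz
        R = point′ g α x′ y′ nz′

theorem3p4 : ∀ {c₁ ℓ₁ c₂ ℓ₂} (q h : ℕ) → IsPrimePower q → 2 ≤ h →
  (F : Field c₁ ℓ₁) (K : Field c₂ ℓ₂) (E : Extension F K) →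
  HasOrder F q → HasOrder K (q ^ h) →
  let module F = Field F
      module K = Field K
      open Extension E
      open LinearSets E
  in
  (f g : K.Carrier → F.Carrier) →
  IsLinearFunctional f → IsNonzeroFunctional f →
  IsLinearFunctional g → IsNonzeroFunctional g →
  (α : K.Carrier) (α∉F : ¬ InBase α) →
  g K.1# F.≈ F.1# → g α F.≈ F.1# →
  f (K.1# K./ α [ ∉Base⇒≉0 α∉F ]) F.≉ F.0# →
  (∀ k (k≉0 : k F.≉ F.0#) (k≉1 : k F.≉ F.1#) →
    f ((ι k K.- K.1#) K./ denominator k α [ denominator≉0 α∉F k≉0 k≉1 ]) F.≉ F.1#) →
  𝓛 f ⊥ 𝓛′ g α
theorem3p4 _ _ _ _ _ _ E _ _ _ _ f-linear _ g-linear _ _ α∉F g[1]≈1 g[α]≈1 f[1/α]≉0 f≉1 {P} =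
  𝓛⊥𝓛′ f-linear α∉F f[1/α]≉0 f≉1 g-linear g[1]≈1 g[α]≈1 {P}
  where open ExtensionProperties E
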